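{- Let $a<b$ be two positive integers. Let $G$ be a finite simple graph of order $n\geq 2(a+b)(a+b-1)/a$ with minimum degree $\delta(G)\geq \frac{1}{4a}\left((a+b-1)^2+4b\right)$. If $|N_G(u)\cup N_G(v)|\geq \frac{bn}{a+b}$ for any two nonadjacent vertices $u$ and $v$ of $G$, then $G$ has all fractional $[a,b]$-factors.
   Context: $N_G(x)$ denotes the set of neighbours of $x$ in $G$. For an integer-valued function $q$ on $V(G)$, a fractional $q$-factor of $G$ is a function $h:E(G)\rightarrow[0,1]$ such that $\sum_{e\ni x}h(e)=q(x)$ for every vertex $x$ (sum over edges incident with $x$). $G$ has all fractional $[a,b]$-factors if $G$ has a fractional $q$-factor for every integer-valued function $q$ on $V(G)$ with $a\leq q(v)\leq b$ for all $v\in V(G)$. -}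

module Defs where

open import Data.Nat as ℕ using (ℕ; zero; suc)
open import Data.Integer using (+_)
open import Data.Fin using (Fin; zero; suc)
open import Data.Bool using (Bool; true; false; if_then_else_; _∨_)
open import Data.Rational as ℚ using (ℚ; 0ℚ; 1ℚ; _/_)
open import Relation.Binary.PropositionalEquality using (_≡_)
open import Data.Product using (_×_)

record SimpleGraph (n : ℕ) : Set where
  field
    adj    : Fin n → Fin n → Bool
    sym    : ∀ x y → adj x y ≡ adj y x
    irrefl : ∀ x → adj x x ≡ false
open SimpleGraph public

sumℕ : ∀ {n} → (Fin n → ℕ) → ℕ
sumℕ {zero}  f = 0
sumℕ {suc n} f = f zero ℕ.+ sumℕ (λ i → f (suc i))

sumℚ : ∀ {n} → (Fin n → ℚ) → ℚ
sumℚ {zero}  f = 0ℚ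
sumℚ {suc n} f = f zero ℚ.+ sumℚ (λ i → f (suc i))

degree : ∀ {n} → SimpleGraph n → Fin n → ℕ
degree G x = sumℕ (λ y → if adj G x y then 1 else 0)

unionNbhdSize : ∀ {n} → SimpleGraph n → Fin n → Fin n → ℕ
unionNbhdSize G u v = sumℕ (λ y → if adj G u y ∨ adj G v y then 1 else 0)

ℕtoℚ : ℕ → ℚ
ℕtoℚ k = (+ k) / 1

-- A fractional q-factor: a weight on the edges of G with values in [0,1]
-- such that the sum of weights of edges at x equals q(x).  An edge {x,y}
-- is represented by the ordered pairs (x,y),(y,x); h is required to be
-- symmetric so it is a function of the unordered edge.  Values of h on
-- non-edges are irrelevant (never used).
IsFractionalFactor : ∀ {n} → SimpleGraph n → (Fin n → ℕ) → (Fin n → Fin n → ℚ) → Set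
IsFractionalFactor G q h =
    (∀ x y → adj G x y ≡ true → h x y ≡ h y x)
  × (∀ x y → adj G x y ≡ true → (0ℚ ℚ.≤ h x y) × (h x y ℚ.≤ 1ℚ))
  × (∀ x → sumℚ (λ y → if adj G x y then h x y else 0ℚ) ≡ ℕtoℚ (q x))

HasFractionalFactor : ∀ {n} → SimpleGraph n → (Fin n → ℕ) → Set
HasFractionalFactor {n} G q = Data.Product.Σ (Fin n → Fin n → ℚ) (IsFractionalFactor G q)

HasAllFractionalFactors : ∀ {n} → SimpleGraph n → ℕ → ℕ → Set
HasAllFractionalFactors {n} G a b =
  (q : Fin n → ℕ) → (∀ x → (a ℕ.≤ q x) × (q x ℕ.≤ b)) → HasFractionalFactor G q

{-# OPTIONS --safe #-}

-- A fractional q-factor is the average of w and its transpose, where w is an integral flow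
-- with margins q in the bipartite double cover of G.  If no such w exists, max-flow/min-cut
-- gives disjoint S and T with a|S| + Σ_{x∈T} (d_{G-S}(x) - b) < 0 and d_{G-S} ≤ b on T.
-- Let x₁ minimise d_{G-S} on T.  If T ⊆ N[x₁], the minimum degree condition is violated;
-- otherwise let x₂ minimise d_{G-S} on T \ N[x₁], and then the union condition on x₁, x₂
-- together with the bound on n is violated.
module Submission where

open import Defs hiding (sym)
open import Data.Bool using (Bool; true; false; if_then_else_; _∧_; _∨_; not)
import Data.Bool.Properties as Bool
open import Data.Empty using (⊥; ⊥-elim)
open import Data.Fin using (Fin; zero; suc)
import Data.Fin.Properties as Fin
import Data.Integer as ℤ
open import Data.Nat as ℕ using (ℕ; zero; suc)
import Data.Nat.Properties as ℕ
open import Data.Product using (_×_; _,_; ∃; ∃₂; proj₁; proj₂)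
open import Data.Sum using (_⊎_; inj₁; inj₂)
open import Function using (_∘_)
open import Relation.Nullary using (¬_; does; yes; no)
open import Relation.Binary.PropositionalEquality
  using (_≡_; refl; sym; trans; cong; cong₂; subst; module ≡-Reasoning)

-- A cut `X`, `Y` of the double cover may contain a vertex on both sides. Symmetry of adjacency
-- allows the common vertices to be deleted without enlarging the cut, and this is how disjoint sets
-- of G arise. The constants come from eliminating |S| and |T|. Write h₁, h₂ for d_{G-S} at x₁, x₂.
-- If T lies in N[x₁], then |T| ≤ h₁ + 1 and δ ≤ |S| + h₁ bound the left side of the deficiency
-- inequality below by (h₁ + 1)(h₁ - b) + a(δ - h₁). Over real h₁ its minimum, at (a + b - 1)/2, is
-- aδ - ((a + b - 1)² + 4b)/4, which the degree hypothesis makes nonnegative. Otherwise |T| ≤ n -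
-- |S| and |S| ≥ bn/(a + b) - h₁ - h₂ leave n with the coefficient a h₂/(a + b); the bound on n
-- makes that term at least 2h₂(a + b - 1), which has to pay for what remains in a, b, h₁, h₂.

module Transport where

  open import Data.Integer hiding (suc)
  open import Data.Integer.Properties
  open import Data.Integer.Tactic.RingSolver using (solve-∀)
  import Algebra.Properties.Semiring.Sum +-*-semiring as Sum

  private variable
    m n : ℕ

  -- Integer inequalities and finite sums.

  -- Splits an inequality into a ring identity, left to the solver, and the nonnegativity of an
  -- expression assembled from the hypotheses.
  ≤-byDifference : ∀ {i j d} → j - i ≡ d → 0ℤ ≤ d → i ≤ j
  ≤-byDifference eq 0≤d = 0≤i-j⇒j≤i (≤-trans 0≤d (≤-reflexive (sym eq)))

  0≤* : ∀ {i j} → 0ℤ ≤ i → 0ℤ ≤ j → 0ℤ ≤ i * j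
  0≤* {+ i} {+ j} _ _ = ≤-trans (+≤+ ℕ.z≤n) (≤-reflexive (pos-* i j))

  0≤+ : ∀ {i j} → 0ℤ ≤ i → 0ℤ ≤ j → 0ℤ ≤ i + j
  0≤+ = +-mono-≤

  -- Opaque, since the elaborator otherwise unfolds the library sum and cannot infer the summand.
  opaque
    ∑ : (Fin n → ℤ) → ℤ
    ∑ = Sum.sum

    ∑-empty : (f : Fin 0 → ℤ) → ∑ f ≡ 0ℤ
    ∑-empty f = refl

    ∑-suc : (f : Fin (suc n) → ℤ) → ∑ f ≡ f zero + ∑ (f ∘ suc)
    ∑-suc f = refl

    ∑-cong : {f g : Fin n → ℤ} → (∀ i → f i ≡ g i) → ∑ f ≡ ∑ g
    ∑-cong = Sum.sum-cong-≗

    ∑-+ : (f g : Fin n → ℤ) → ∑ (λ i → f i + g i) ≡ ∑ f + ∑ g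
    ∑-+ = Sum.∑-distrib-+

    ∑-comm : (f : Fin m → Fin n → ℤ) → ∑ (λ i → ∑ (f i)) ≡ ∑ (λ j → ∑ (λ i → f i j))
    ∑-comm = Sum.∑-comm

    ∑-*ˡ : (k : ℤ) (f : Fin n → ℤ) → ∑ (λ i → k * f i) ≡ k * ∑ f
    ∑-*ˡ k f = sym (Sum.*-distribˡ-sum k f)

    ∑-mono : {f g : Fin n → ℤ} → (∀ i → f i ≤ g i) → ∑ f ≤ ∑ g
    ∑-mono {zero}  f≤g = ≤-refl
    ∑-mono {suc n} f≤g = +-mono-≤ (f≤g zero) (∑-mono (f≤g ∘ suc))

    ∑-zero : {f : Fin n → ℤ} → (∀ i → f i ≡ 0ℤ) → ∑ f ≡ 0ℤ
    ∑-zero {n} f≡0 = trans (∑-cong f≡0) (Sum.sum-replicate-zero n)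

    ∑-one : ∀ n → ∑ {n} (λ _ → 1ℤ) ≡ + n
    ∑-one zero    = refl
    ∑-one (suc n) = cong (_+_ 1ℤ) (∑-one n)

  ∑-nonneg : {f : Fin n → ℤ} → (∀ i → 0ℤ ≤ f i) → 0ℤ ≤ ∑ f
  ∑-nonneg 0≤f = ≤-trans (≤-reflexive (sym (∑-zero {f = λ _ → 0ℤ} (λ _ → refl)))) (∑-mono 0≤f)

  ∑-neg : (f : Fin n → ℤ) → ∑ (λ i → - f i) ≡ - ∑ f
  ∑-neg f = trans (∑-cong (λ i → sym (-1*i≡-i (f i)))) (trans (∑-*ˡ -1ℤ f) (-1*i≡-i (∑ f)))

  ∑-minus : (f g : Fin n → ℤ) → ∑ (λ i → f i - g i) ≡ ∑ f - ∑ g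
  ∑-minus f g = trans (∑-+ f (λ i → - g i)) (cong (_+_ (∑ f)) (∑-neg g))

  ∑∑-+ : (f g : Fin m → Fin n → ℤ) →
    ∑ (λ u → ∑ (λ v → f u v + g u v)) ≡ ∑ (λ u → ∑ (f u)) + ∑ (λ u → ∑ (g u))
  ∑∑-+ f g = trans (∑-cong (λ u → ∑-+ (f u) (g u))) (∑-+ (∑ ∘ f) (∑ ∘ g))

  ι : Bool → ℤ
  ι b = if b then 1ℤ else 0ℤ

  ι≥0 : ∀ b → 0ℤ ≤ ι b
  ι≥0 false = +≤+ ℕ.z≤n
  ι≥0 true  = +≤+ ℕ.z≤n

  δ : Fin n → Fin n → ℤ
  δ x u = ι (does (x Fin.≟ u))

  ∑-δ : (f : Fin n → ℤ) (x : Fin n) → ∑ (λ u → f u * δ x u) ≡ f x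
  ∑-δ f zero    = trans (∑-suc (λ u → f u * δ zero u))
    (trans (cong₂ _+_ (*-identityʳ (f zero)) (∑-zero (λ i → *-zeroʳ (f (suc i))))) (+-identityʳ (f zero)))
  ∑-δ f (suc x) = trans (∑-suc (λ u → f u * δ (suc x) u))
    (trans (cong₂ _+_ (*-zeroʳ (f zero)) (∑-δ (f ∘ suc) x)) (+-identityˡ (f (suc x))))

  ∑∑-δδ : (f : Fin m → Fin n → ℤ) (x : Fin m) (y : Fin n) →
          ∑ (λ u → ∑ (λ v → f u v * (δ x u * δ y v))) ≡ f x y
  ∑∑-δδ f x y = begin
    ∑ (λ u → ∑ (λ v → f u v * (δ x u * δ y v)))
      ≡⟨ ∑-cong (λ u → ∑-cong (λ v → sym (*-assoc (f u v) (δ x u) (δ y v)))) ⟩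
    ∑ (λ u → ∑ (λ v → f u v * δ x u * δ y v))
      ≡⟨ ∑-cong (λ u → ∑-δ (λ v → f u v * δ x u) y) ⟩
    ∑ (λ u → f u y * δ x u)
      ≡⟨ ∑-δ (λ u → f u y) x ⟩
    f x y ∎
    where open ≡-Reasoning

  -- Cuts of a bipartite network and supermodularity of the excess.

  volume : (Fin n → Bool) → (Fin n → ℤ) → ℤ
  volume X r = ∑ (λ u → ι (X u) * r u)

  cut : (Fin m → Fin n → ℤ) → (Fin m → Bool) → (Fin n → Bool) → ℤ
  cut K X Y = ∑ (λ u → ∑ (λ v → ι (X u ∧ not (Y v)) * K u v))

  -- Gale's obstruction: the rows in `X` must send `volume X r`, of which at most `volume Y c` fits
  -- into the columns of `Y` and at most `cut K X Y` can go elsewhere. A positive value rules out a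
  -- flow.
  excess : (Fin m → ℤ) → (Fin n → ℤ) → (Fin m → Fin n → ℤ) →
           (Fin m → Bool) → (Fin n → Bool) → ℤ
  excess r c K X Y = volume X r - volume Y c - cut K X Y

  volume-modular : (X₁ X₂ : Fin n → Bool) (r : Fin n → ℤ) →
    volume X₁ r + volume X₂ r ≡
    volume (λ u → X₁ u ∧ X₂ u) r + volume (λ u → X₁ u ∨ X₂ u) r
  volume-modular X₁ X₂ r = begin
    volume X₁ r + volume X₂ r
      ≡⟨ sym (∑-+ (λ u → ι (X₁ u) * r u) (λ u → ι (X₂ u) * r u)) ⟩
    ∑ (λ u → ι (X₁ u) * r u + ι (X₂ u) * r u)
      ≡⟨ ∑-cong (λ u → pointwise (X₁ u) (X₂ u) (r u)) ⟩
    ∑ (λ u → ι (X₁ u ∧ X₂ u) * r u + ι (X₁ u ∨ X₂ u) * r u)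
      ≡⟨ ∑-+ (λ u → ι (X₁ u ∧ X₂ u) * r u) (λ u → ι (X₁ u ∨ X₂ u) * r u) ⟩
    volume (λ u → X₁ u ∧ X₂ u) r + volume (λ u → X₁ u ∨ X₂ u) r ∎
    where
    open ≡-Reasoning
    pointwise : ∀ p q k → ι p * k + ι q * k ≡ ι (p ∧ q) * k + ι (p ∨ q) * k
    pointwise false q     k = refl
    pointwise true  false k = +-comm (1ℤ * k) 0ℤ
    pointwise true  true  k = refl

  -- Holds pair by pair. The two sides count a pair (u, v) equally often, except when u lies in only
  -- one of the `X` and v in only the other `Y`: such a pair is counted once on the right and never
  -- on the left.
  cut-submodular : (K : Fin m → Fin n → ℤ) → (∀ u v → 0ℤ ≤ K u v) →
    (X₁ X₂ : Fin m → Bool) (Y₁ Y₂ : Fin n → Bool) →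
    cut K (λ u → X₁ u ∧ X₂ u) (λ v → Y₁ v ∧ Y₂ v) +
    cut K (λ u → X₁ u ∨ X₂ u) (λ v → Y₁ v ∨ Y₂ v) ≤ cut K X₁ Y₁ + cut K X₂ Y₂
  cut-submodular K K≥0 X₁ X₂ Y₁ Y₂ = ≤-trans (≤-reflexive (sym (∑∑-+ _ _)))
    (≤-trans (∑-mono (λ u → ∑-mono (λ v → pointwise (X₁ u) (X₂ u) (Y₁ v) (Y₂ v) (K≥0 u v))))
             (≤-reflexive (∑∑-+ _ _)))
    where
    coefficients : ∀ p q s t → ι ((p ∧ q) ∧ not (s ∧ t)) + ι ((p ∨ q) ∧ not (s ∨ t)) ≤
                               ι (p ∧ not s) + ι (q ∧ not t)
    coefficients false false s     t     = ≤-refl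
    coefficients false true  false t     = ≤-refl
    coefficients false true  true  t     = ≤-trans (ι≥0 (not t)) (i≤j+i _ 0ℤ)
    coefficients true  false false false = ≤-refl
    coefficients true  false false true  = +≤+ ℕ.z≤n
    coefficients true  false true  t     = ≤-refl
    coefficients true  true  false false = ≤-refl
    coefficients true  true  false true  = ≤-refl
    coefficients true  true  true  false = ≤-refl
    coefficients true  true  true  true  = ≤-refl

    pointwise : ∀ p q s t {k} → 0ℤ ≤ k →
      ι ((p ∧ q) ∧ not (s ∧ t)) * k + ι ((p ∨ q) ∧ not (s ∨ t)) * k ≤
      ι (p ∧ not s) * k + ι (q ∧ not t) * k
    pointwise p q s t {k} 0≤k = ≤-byDifference
      (eq (ι ((p ∧ q) ∧ not (s ∧ t))) (ι ((p ∨ q) ∧ not (s ∨ t))) (ι (p ∧ not s)) (ι (q ∧ not t)) k)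
      (0≤* (i≤j⇒0≤j-i (coefficients p q s t)) 0≤k)
      where
      eq : ∀ A B C D k → (C * k + D * k) - (A * k + B * k) ≡ ((C + D) - (A + B)) * k
      eq = solve-∀

  -- Volumes are modular, and the submodular cut enters with a minus sign.
  excess-supermodular : (r : Fin m → ℤ) (c : Fin n → ℤ) (K : Fin m → Fin n → ℤ) →
    (∀ u v → 0ℤ ≤ K u v) → (X₁ X₂ : Fin m → Bool) (Y₁ Y₂ : Fin n → Bool) →
    excess r c K X₁ Y₁ + excess r c K X₂ Y₂ ≤
    excess r c K (λ u → X₁ u ∧ X₂ u) (λ v → Y₁ v ∧ Y₂ v) +
    excess r c K (λ u → X₁ u ∨ X₂ u) (λ v → Y₁ v ∨ Y₂ v)
  excess-supermodular r c K K≥0 X₁ X₂ Y₁ Y₂ = begin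
    excess r c K X₁ Y₁ + excess r c K X₂ Y₂
      ≡⟨ regroup (volume X₁ r) (volume Y₁ c) (cut K X₁ Y₁) (volume X₂ r) (volume Y₂ c) (cut K X₂ Y₂) ⟩
    (volume X₁ r + volume X₂ r) - (volume Y₁ c + volume Y₂ c) - (cut K X₁ Y₁ + cut K X₂ Y₂)
      ≡⟨ cong₂ (λ s t → s - t - (cut K X₁ Y₁ + cut K X₂ Y₂))
               (volume-modular X₁ X₂ r) (volume-modular Y₁ Y₂ c) ⟩
    (volume X∧ r + volume X∨ r) - (volume Y∧ c + volume Y∨ c) - (cut K X₁ Y₁ + cut K X₂ Y₂)
      ≤⟨ +-monoʳ-≤ ((volume X∧ r + volume X∨ r) - (volume Y∧ c + volume Y∨ c))
                   (neg-mono-≤ (cut-submodular K K≥0 X₁ X₂ Y₁ Y₂)) ⟩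
    (volume X∧ r + volume X∨ r) - (volume Y∧ c + volume Y∨ c) - (cut K X∧ Y∧ + cut K X∨ Y∨)
      ≡⟨ sym (regroup (volume X∧ r) (volume Y∧ c) (cut K X∧ Y∧) (volume X∨ r) (volume Y∨ c) (cut K X∨ Y∨)) ⟩
    excess r c K X∧ Y∧ + excess r c K X∨ Y∨ ∎
    where
    open ≤-Reasoning
    X∧ = λ u → X₁ u ∧ X₂ u
    X∨ = λ u → X₁ u ∨ X₂ u
    Y∧ = λ v → Y₁ v ∧ Y₂ v
    Y∨ = λ v → Y₁ v ∨ Y₂ v
    regroup : ∀ a b c a′ b′ c′ → (a - b - c) + (a′ - b′ - c′) ≡ (a + a′) - (b + b′) - (c + c′)
    regroup = solve-∀

  -- Removing one unit of capacity, or one unit of demand and supply.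

  volume-minus-δ : (X : Fin n → Bool) (r : Fin n → ℤ) (x : Fin n) →
    volume X (λ u → r u - δ x u) ≡ volume X r - ι (X x)
  volume-minus-δ X r x = begin
    volume X (λ u → r u - δ x u)
      ≡⟨ ∑-cong (λ u → distrib (ι (X u)) (r u) (δ x u)) ⟩
    ∑ (λ u → ι (X u) * r u - ι (X u) * δ x u)
      ≡⟨ ∑-minus (λ u → ι (X u) * r u) (λ u → ι (X u) * δ x u) ⟩
    volume X r - ∑ (λ u → ι (X u) * δ x u)
      ≡⟨ cong (λ s → volume X r - s) (∑-δ (ι ∘ X) x) ⟩
    volume X r - ι (X x) ∎
    where
    open ≡-Reasoning
    distrib : ∀ i j k → i * (j - k) ≡ i * j - i * k
    distrib = solve-∀

  removeEdge : (Fin m → Fin n → ℤ) → Fin m → Fin n → Fin m → Fin n → ℤ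
  removeEdge K x y u v = K u v - δ x u * δ y v

  ∑∑-minus : (f g : Fin m → Fin n → ℤ) →
    ∑ (λ u → ∑ (λ v → f u v - g u v)) ≡ ∑ (λ u → ∑ (f u)) - ∑ (λ u → ∑ (g u))
  ∑∑-minus f g = trans (∑-cong (λ u → ∑-minus (f u) (g u))) (∑-minus (∑ ∘ f) (∑ ∘ g))

  -- The weight `ω` is arbitrary so that one computation serves both the cut, with an indicator as
  -- weight, and the total capacity, with weight one.
  ∑∑-weighted-removeEdge : (ω K : Fin m → Fin n → ℤ) (x : Fin m) (y : Fin n) →
    ∑ (λ u → ∑ (λ v → ω u v * removeEdge K x y u v)) ≡ ∑ (λ u → ∑ (λ v → ω u v * K u v)) - ω x y
  ∑∑-weighted-removeEdge ω K x y = begin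
    ∑ (λ u → ∑ (λ v → ω u v * removeEdge K x y u v))
      ≡⟨ ∑-cong (λ u → ∑-cong (λ v → distrib (ω u v) (K u v) (δ x u * δ y v))) ⟩
    ∑ (λ u → ∑ (λ v → ω u v * K u v - ω u v * (δ x u * δ y v)))
      ≡⟨ ∑∑-minus (λ u v → ω u v * K u v) (λ u v → ω u v * (δ x u * δ y v)) ⟩
    ∑ (λ u → ∑ (λ v → ω u v * K u v)) - ∑ (λ u → ∑ (λ v → ω u v * (δ x u * δ y v)))
      ≡⟨ cong (λ s → ∑ (λ u → ∑ (λ v → ω u v * K u v)) - s) (∑∑-δδ ω x y) ⟩
    ∑ (λ u → ∑ (λ v → ω u v * K u v)) - ω x y ∎
    where
    open ≡-Reasoning
    distrib : ∀ i j k → i * (j - k) ≡ i * j - i * k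
    distrib = solve-∀

  ∑∑-removeEdge : (K : Fin m → Fin n → ℤ) (x : Fin m) (y : Fin n) →
    ∑ (λ u → ∑ (removeEdge K x y u)) ≡ ∑ (λ u → ∑ (K u)) - 1ℤ
  ∑∑-removeEdge K x y = begin
    ∑ (λ u → ∑ (removeEdge K x y u))
      ≡⟨ ∑-cong (λ u → ∑-cong (λ v → sym (*-identityˡ (removeEdge K x y u v)))) ⟩
    ∑ (λ u → ∑ (λ v → 1ℤ * removeEdge K x y u v))
      ≡⟨ ∑∑-weighted-removeEdge (λ _ _ → 1ℤ) K x y ⟩
    ∑ (λ u → ∑ (λ v → 1ℤ * K u v)) - 1ℤ
      ≡⟨ cong (_- 1ℤ) (∑-cong (λ u → ∑-cong (λ v → *-identityˡ (K u v)))) ⟩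
    ∑ (λ u → ∑ (K u)) - 1ℤ ∎
    where open ≡-Reasoning

  excess-removeEdge : (r : Fin m → ℤ) (c : Fin n → ℤ) (K : Fin m → Fin n → ℤ)
    (x : Fin m) (y : Fin n) (X : Fin m → Bool) (Y : Fin n → Bool) →
    excess r c K X Y ≡ excess r c (removeEdge K x y) X Y - ι (X x ∧ not (Y y))
  excess-removeEdge r c K x y X Y = trans
    (regroup (volume X r - volume Y c) (cut K X Y) (ι (X x ∧ not (Y y))))
    (cong (λ s → volume X r - volume Y c - s - ι (X x ∧ not (Y y)))
          (sym (∑∑-weighted-removeEdge (λ u v → ι (X u ∧ not (Y v))) K x y)))
    where
    regroup : ∀ p q s → p - q ≡ p - (q - s) - s
    regroup = solve-∀

  excess-minus-δ : (r : Fin m → ℤ) (c : Fin n → ℤ) (K : Fin m → Fin n → ℤ)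
    (x : Fin m) (y : Fin n) (X : Fin m → Bool) (Y : Fin n → Bool) →
    excess (λ u → r u - δ x u) (λ v → c v - δ y v) K X Y ≡ excess r c K X Y - ι (X x) + ι (Y y)
  excess-minus-δ r c K x y X Y = trans
    (cong₂ (λ s t → s - t - cut K X Y) (volume-minus-δ X r x) (volume-minus-δ Y c y))
    (regroup (volume X r) (volume Y c) (cut K X Y) (ι (X x)) (ι (Y y)))
    where
    regroup : ∀ a b k s t → (a - s) - (b - t) - k ≡ a - b - k - s + t
    regroup = solve-∀

  -- Flow or violated cut, by induction on the total capacity.

  -- One-sided margins suit the induction, during which the values of `r` can fall below zero. When
  -- both margins have the same total, equality is recovered by `∑-squeeze`.
  Feasible : (Fin m → ℤ) → (Fin n → ℤ) → (Fin m → Fin n → ℤ) → Set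
  Feasible {m} {n} r c K = ∃ λ (w : Fin m → Fin n → ℤ) → (∀ u v → 0ℤ ≤ w u v × w u v ≤ K u v) ×
                           (∀ u → r u ≤ ∑ (w u)) × (∀ v → ∑ (λ u → w u v) ≤ c v)

  Violated : (Fin m → ℤ) → (Fin n → ℤ) → (Fin m → Fin n → ℤ) → Set
  Violated {m} {n} r c K = ∃₂ λ (X : Fin m → Bool) (Y : Fin n → Bool) → 1ℤ ≤ excess r c K X Y

  module Step (r : Fin m → ℤ) (c : Fin n → ℤ) (K : Fin m → Fin n → ℤ)
              (K≥0 : ∀ u v → 0ℤ ≤ K u v) (x : Fin m) (y : Fin n) (1≤Kxy : 1ℤ ≤ K x y) where

    K′ : Fin m → Fin n → ℤ
    K′ = removeEdge K x y

    δδ≥0 : ∀ u v → 0ℤ ≤ δ x u * δ y v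
    δδ≥0 u v = 0≤* (ι≥0 (does (x Fin.≟ u))) (ι≥0 (does (y Fin.≟ v)))

    K′≥0 : ∀ u v → 0ℤ ≤ K′ u v
    K′≥0 u v with x Fin.≟ u | y Fin.≟ v
    ... | yes refl | yes refl = i≤j⇒0≤j-i 1≤Kxy
    ... | yes refl | no _     = ≤-trans (K≥0 u v) (≤-reflexive (sym (+-identityʳ (K u v))))
    ... | no _     | _        = ≤-trans (K≥0 u v) (≤-reflexive (sym (+-identityʳ (K u v))))

    feasible-without : Feasible r c K′ → Feasible r c K
    feasible-without (w , bounds , rows , columns) =
      w , (λ u v → proj₁ (bounds u v) , ≤-trans (proj₂ (bounds u v)) (K′≤K u v)) , rows , columns
      where
      cancel : ∀ i j → i - (i - j) ≡ j
      cancel = solve-∀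
      K′≤K : ∀ u v → K′ u v ≤ K u v
      K′≤K u v = ≤-byDifference (cancel (K u v) (δ x u * δ y v)) (δδ≥0 u v)

    feasible-with : Feasible (λ u → r u - δ x u) (λ v → c v - δ y v) K′ → Feasible r c K
    feasible-with (w , bounds , rows , columns) =
      (λ u v → w u v + δ x u * δ y v) ,
      (λ u v → 0≤+ (proj₁ (bounds u v)) (δδ≥0 u v) ,
               ≤-trans (+-monoˡ-≤ (δ x u * δ y v) (proj₂ (bounds u v)))
                       (≤-reflexive (restore (K u v) (δ x u * δ y v)))) ,
      (λ u → ≤-trans (≤-reflexive (sym (restore (r u) (δ x u))))
               (≤-trans (+-monoˡ-≤ (δ x u) (rows u)) (≤-reflexive (sym (row-sum u))))) ,
      (λ v → ≤-trans (≤-reflexive (column-sum v))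
               (≤-trans (+-monoˡ-≤ (δ y v) (columns v)) (≤-reflexive (restore (c v) (δ y v)))))
      where
      restore : ∀ i j → i - j + j ≡ i
      restore = solve-∀
      row-sum : ∀ u → ∑ (λ v → w u v + δ x u * δ y v) ≡ ∑ (w u) + δ x u
      row-sum u = trans (∑-+ (w u) (λ v → δ x u * δ y v))
                        (cong (_+_ (∑ (w u))) (∑-δ (λ _ → δ x u) y))
      column-sum : ∀ v → ∑ (λ u → w u v + δ x u * δ y v) ≡ ∑ (λ u → w u v) + δ y v
      column-sum v = trans (∑-+ (λ u → w u v) (λ u → δ x u * δ y v))
        (cong (_+_ (∑ (λ u → w u v)))
              (trans (∑-cong (λ u → *-comm (δ x u) (δ y v))) (∑-δ (λ _ → δ y v) x)))

    violated : ∀ X Y → 1ℤ ≤ excess r c K′ X Y - ι (X x ∧ not (Y y)) → Violated r c K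
    violated X Y h = X , Y , ≤-trans h (≤-reflexive (sym (excess-removeEdge r c K x y X Y)))

    -- Restoring the edge costs a cut one unit only if the edge crosses it, so the first cut
    -- survives unless `x` is in `X₁` and `y` is not in `Y₁`. The second cut survives unless `x` is
    -- outside `X₂` and `y` inside `Y₂`: in particular, when the edge crosses it, the unit of demand
    -- already removed at `x` pays for the loss. If both fail, the intersection or the union of the
    -- two cuts is violated.
    uncross : Violated r c K′ → Violated (λ u → r u - δ x u) (λ v → c v - δ y v) K′ →
              Violated r c K
    uncross (X₁ , Y₁ , h₁) (X₂ , Y₂ , h₂) = cases _ refl _ refl _ refl _ refl
      where
      D : (Fin m → Bool) → (Fin n → Bool) → ℤ
      D = excess r c K′
      h₂′ : ∀ {p q} → X₂ x ≡ p → Y₂ y ≡ q → 1ℤ ≤ D X₂ Y₂ - ι p + ι q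
      h₂′ refl refl = ≤-trans h₂ (≤-reflexive (excess-minus-δ r c K′ x y X₂ Y₂))

      zero-loss : ∀ X Y {b} → X x ∧ not (Y y) ≡ b → b ≡ false → 1ℤ ≤ D X Y → Violated r c K
      zero-loss X Y refl q h = violated X Y (subst (λ b → 1ℤ ≤ D X Y - ι b) (sym q)
        (≤-trans h (≤-reflexive (sym (+-identityʳ (D X Y))))))

      ∧∧ : Fin m → Bool
      ∧∧ u = X₁ u ∧ X₂ u

      cases : ∀ p → X₁ x ≡ p → ∀ s → Y₁ y ≡ s → ∀ q → X₂ x ≡ q → ∀ t → Y₂ y ≡ t → Violated r c K
      cases false e₁ _     _  _     _  _     _  = zero-loss X₁ Y₁ (cong (_∧ _) e₁) refl h₁
      cases true  e₁ true  e₂ _     _  _     _  = zero-loss X₁ Y₁ (cong₂ (λ a b → a ∧ not b) e₁ e₂) refl h₁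
      cases true  e₁ false e₂ true  e₃ true  e₄ =
        zero-loss X₂ Y₂ (cong₂ (λ a b → a ∧ not b) e₃ e₄) refl
          (≤-trans (h₂′ e₃ e₄) (≤-reflexive (cancel (D X₂ Y₂))))
        where
        cancel : ∀ i → i - 1ℤ + 1ℤ ≡ i
        cancel = solve-∀
      cases true  e₁ false e₂ true  e₃ false e₄ =
        violated X₂ Y₂ (≤-trans (h₂′ e₃ e₄) (≤-reflexive
          (trans (+-identityʳ _) (cong (λ b → D X₂ Y₂ - ι b) (sym (cong₂ (λ a b → a ∧ not b) e₃ e₄))))))
      cases true  e₁ false e₂ false e₃ false e₄ =
        zero-loss X₂ Y₂ (cong (_∧ _) e₃) refl
          (≤-trans (h₂′ e₃ e₄) (≤-reflexive (cancel (D X₂ Y₂))))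
        where
        cancel : ∀ i → i - 0ℤ + 0ℤ ≡ i
        cancel = solve-∀
      -- The remaining case, where `D X₂ Y₂` is only known to be nonnegative. Since `x` is missing
      -- from the intersection and `y` belongs to the union, the edge crosses neither of these cuts;
      -- by supermodularity their excesses add up to at least one, so one of them is positive.
      cases true  e₁ false e₂ false e₃ true  e₄ with 1ℤ ≤? D ∧∧ (λ v → Y₁ v ∧ Y₂ v)
      ... | yes 1≤D∩ = zero-loss ∧∧ _ (cong₂ (λ a b → (a ∧ b) ∧ not (Y₁ y ∧ Y₂ y)) e₁ e₃) refl 1≤D∩
      ... | no  1≰D∩ = zero-loss (λ u → X₁ u ∨ X₂ u) (λ v → Y₁ v ∨ Y₂ v)
                         (cong₂ (λ a b → (X₁ x ∨ X₂ x) ∧ not (a ∨ b)) e₂ e₄) (Bool.∧-zeroʳ (X₁ x ∨ X₂ x))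
                         (≤-byDifference
                           (certificate (D X₁ Y₁) (D X₂ Y₂) (D ∧∧ (λ v → Y₁ v ∧ Y₂ v)) _)
                           (0≤+ (0≤+ (0≤+
                           (i≤j⇒0≤j-i (excess-supermodular r c K′ K′≥0 X₁ X₂ Y₁ Y₂))
                           (i≤j⇒0≤j-i h₁))
                           (i≤j⇒0≤j-i (h₂′ e₃ e₄)))
                           (i≤j⇒0≤j-i (i<j⇒suc[i]≤j (≰⇒> 1≰D∩)))))
        where
        certificate : ∀ d₁ d₂ d∩ d∪ → d∪ - 1ℤ ≡
          (d∩ + d∪ - (d₁ + d₂)) + (d₁ - 1ℤ) + (d₂ - 0ℤ + 1ℤ - 1ℤ) + (1ℤ - (1ℤ + d∩))
        certificate = solve-∀

  row-violation : (r : Fin m → ℤ) (c : Fin n → ℤ) (K : Fin m → Fin n → ℤ) →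
    (∀ u v → K u v ≤ 0ℤ) → ∀ x → 1ℤ ≤ r x → Violated r c K
  row-violation r c K K≤0 x 1≤rx = (λ u → does (x Fin.≟ u)) , (λ _ → false) ,
    ≤-byDifference (certificate _ _ _ _ volume-x volume-∅)
                   (0≤+ (i≤j⇒0≤j-i 1≤rx) (i≤j⇒0≤j-i cut≤0))
    where
    volume-x : volume (λ u → does (x Fin.≟ u)) r ≡ r x
    volume-x = trans (∑-cong (λ u → *-comm (δ x u) (r u))) (∑-δ r x)
    volume-∅ : volume (λ _ → false) c ≡ 0ℤ
    volume-∅ = ∑-zero (λ _ → refl)
    term : ∀ b {k} → k ≤ 0ℤ → ι b * k ≤ 0ℤ
    term false     k≤0 = ≤-refl
    term true  {k} k≤0 = ≤-trans (≤-reflexive (*-identityˡ k)) k≤0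
    cut≤0 : cut K (λ u → does (x Fin.≟ u)) (λ _ → false) ≤ 0ℤ
    cut≤0 = ≤-trans (∑-mono (λ u → ≤-trans
                (∑-mono (λ v → term (does (x Fin.≟ u) ∧ true) (K≤0 u v)))
                (≤-reflexive (∑-zero (λ _ → refl)))))
              (≤-reflexive (∑-zero {f = λ _ → 0ℤ} (λ _ → refl)))
    certificate : ∀ a b d k → a ≡ d → b ≡ 0ℤ → (a - b - k) - 1ℤ ≡ (d - 1ℤ) + (0ℤ - k)
    certificate a .0ℤ .a k refl refl = ring a k
      where
      ring : ∀ a k → (a - 0ℤ - k) - 1ℤ ≡ (a - 1ℤ) + (0ℤ - k)
      ring = solve-∀

  column-violation : (r : Fin m → ℤ) (c : Fin n → ℤ) (K : Fin m → Fin n → ℤ) →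
    ∀ y → c y ≤ - 1ℤ → Violated r c K
  column-violation r c K y cy≤-1 = (λ _ → false) , (λ v → does (y Fin.≟ v)) ,
    ≤-trans (neg-mono-≤ cy≤-1) (≤-reflexive (sym (total volume-∅ volume-y cut≡0)))
    where
    volume-∅ : volume (λ _ → false) r ≡ 0ℤ
    volume-∅ = ∑-zero (λ _ → refl)
    volume-y : volume (λ v → does (y Fin.≟ v)) c ≡ c y
    volume-y = trans (∑-cong (λ v → *-comm (δ y v) (c v))) (∑-δ c y)
    cut≡0 : cut K (λ _ → false) (λ v → does (y Fin.≟ v)) ≡ 0ℤ
    cut≡0 = ∑-zero (λ u → ∑-zero (λ _ → refl))
    total : ∀ {a b k d} → a ≡ 0ℤ → b ≡ d → k ≡ 0ℤ → a - b - k ≡ - d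
    total {d = d} refl refl refl = ring d
      where
      ring : ∀ d → 0ℤ - d - 0ℤ ≡ - d
      ring = solve-∀

  -- Base of the induction: only the zero flow is left to try, and a single row of positive demand
  -- or a single column of negative supply is already a violated cut.
  edgeless : (r : Fin m → ℤ) (c : Fin n → ℤ) (K : Fin m → Fin n → ℤ) →
    (∀ u v → 0ℤ ≤ K u v) → (∀ u v → K u v ≤ 0ℤ) → Feasible r c K ⊎ Violated r c K
  edgeless r c K K≥0 K≤0 with Fin.any? (λ x → 1ℤ ≤? r x) | Fin.any? (λ y → c y ≤? - 1ℤ)
  ... | yes (x , 1≤rx) | _                = inj₂ (row-violation r c K K≤0 x 1≤rx)
  ... | no _           | yes (y , cy≤-1) = inj₂ (column-violation r c K y cy≤-1)
  ... | no r≤0         | no c≥0           = inj₁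
    ((λ _ _ → 0ℤ) , (λ u v → ≤-refl , K≥0 u v) ,
     (λ u → ≤-trans (i<j⇒i≤pred[j] (≰⇒> (λ h → r≤0 (u , h)))) (≤-reflexive (sym ∑0≡0))) ,
     (λ v → ≤-trans (≤-reflexive ∑0≡0) (i<j⇒suc[i]≤j (≰⇒> (λ h → c≥0 (v , h))))))
    where
    ∑0≡0 : ∀ {k} → ∑ {k} (λ _ → 0ℤ) ≡ 0ℤ
    ∑0≡0 = ∑-zero (λ _ → refl)

  -- Min-cut without augmenting paths: either deleting an edge or using it must succeed, for otherwise
  -- the two violated cuts uncross to a violated cut of K.
  transport : (k : ℕ) (r : Fin m → ℤ) (c : Fin n → ℤ) (K : Fin m → Fin n → ℤ) →
    (∀ u v → 0ℤ ≤ K u v) → ∑ (λ u → ∑ (K u)) ≤ + k → Feasible r c K ⊎ Violated r c K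
  transport k r c K K≥0 total with Fin.any? (λ x → Fin.any? (λ y → 1ℤ ≤? K x y))
  ... | no none = edgeless r c K K≥0 (λ u v → i<j⇒i≤pred[j] (≰⇒> (λ h → none (u , v , h))))
  ... | yes (x , y , 1≤Kxy) = split k total
    where
    open Step r c K K≥0 x y 1≤Kxy
    total-K′ : ∀ {j} → ∑ (λ u → ∑ (K u)) ≤ j → ∑ (λ u → ∑ (K′ u)) ≤ j - 1ℤ
    total-K′ h = ≤-trans (≤-reflexive (∑∑-removeEdge K x y)) (+-monoˡ-≤ (- 1ℤ) h)
    split : (k : ℕ) → ∑ (λ u → ∑ (K u)) ≤ + k → Feasible r c K ⊎ Violated r c K
    -- Impossible: an edge of capacity at least one is present, so a total of at most zero would
    -- leave the nonnegative `K′` with a negative total.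
    split zero    h with ≤-trans (∑-nonneg (λ u → ∑-nonneg (K′≥0 u))) (total-K′ h)
    ... | ()
    split (suc k) h with transport k r c K′ K′≥0 (total-K′ h)
    ... | inj₁ feasible = inj₁ (feasible-without feasible)
    ... | inj₂ V₁ with transport k (λ u → r u - δ x u) (λ v → c v - δ y v) K′ K′≥0 (total-K′ h)
    ...   | inj₁ feasible = inj₁ (feasible-with feasible)
    ...   | inj₂ V₂       = inj₂ (uncross V₁ V₂)

  -- The two numerical contradictions.

  0≤square : ∀ i → 0ℤ ≤ i * i
  0≤square (+ i)     = 0≤* {+ i} {+ i} (+≤+ ℕ.z≤n) (+≤+ ℕ.z≤n)
  0≤square (-[1+ i ]) = +≤+ ℕ.z≤n

  -- Rests on integrality: between 0 and 1 a real argument would give a negative product.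
  0≤i*[i-1] : ∀ {i} → 0ℤ ≤ i → 0ℤ ≤ i * (i - 1ℤ)
  0≤i*[i-1] {+ zero}  _ = ≤-refl
  0≤i*[i-1] {+ suc i} _ = 0≤* {+ suc i} {+ i} (+≤+ ℕ.z≤n) (+≤+ ℕ.z≤n)

  0≰-1 : ¬ 0ℤ ≤ -1ℤ
  0≰-1 ()

  -- Four times the deficiency inequality fails by (a + b - 1 - 2h)² + 4.
  degree-arithmetic : ∀ a b E s t h D → 0ℤ ≤ a → h ≤ b →
    (a + b - 1ℤ) * (a + b - 1ℤ) + + 4 * b ≤ + 4 * a * D → D ≤ s + h →
    t ≤ h + 1ℤ → t * (h - b) ≤ E → E + a * s ≤ -1ℤ → ⊥
  degree-arithmetic a b E s t h D 0≤a h≤b degree D≤ t≤ E≥ deficient =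
    0≰-1 (≤-trans (0≤+ (0≤+ (0≤+ (0≤+ (0≤+ (0≤+
        (0≤* {+ 4} (+≤+ ℕ.z≤n) (i≤j⇒0≤j-i deficient))
        (0≤* {+ 4} (+≤+ ℕ.z≤n) (i≤j⇒0≤j-i E≥)))
        -- The coefficient `h - b` of `t` is nonpositive, so the upper bound on `t` may be
        -- substituted.
        (0≤* (0≤* {+ 4} (+≤+ ℕ.z≤n) (i≤j⇒0≤j-i h≤b)) (i≤j⇒0≤j-i t≤)))
        (0≤* (0≤* {+ 4} (+≤+ ℕ.z≤n) 0≤a) (i≤j⇒0≤j-i D≤)))
        (i≤j⇒0≤j-i degree))
        (0≤square (a + b - 1ℤ - + 2 * h)))
        (+≤+ (ℕ.z≤n {3})))
      (≤-reflexive (certificate a b E s t h D)))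
    where
    certificate : ∀ a b E s t h D →
      + 4 * (-1ℤ - (E + a * s)) + + 4 * (E - t * (h - b)) + + 4 * (b - h) * (h + 1ℤ - t) +
      + 4 * a * (s + h - D) + (+ 4 * a * D - ((a + b - 1ℤ) * (a + b - 1ℤ) + + 4 * b)) +
      (a + b - 1ℤ - + 2 * h) * (a + b - 1ℤ - + 2 * h) + + 3 ≡ -1ℤ
    certificate = solve-∀

  -- Multiplying the deficiency inequality by a + b eliminates n and s; the certificate is linear in
  -- the hypotheses, with a + b ≥ 3 and h₁ (h₁ - 1) ≥ 0 absorbing the remaining quadratic in h₁, h₂.
  union-arithmetic : ∀ a b n E s t h₁ h₂ U → 1ℤ ≤ a → a + 1ℤ ≤ b →
    0ℤ ≤ h₁ → h₁ ≤ h₂ → h₂ ≤ b → + 2 * (a + b) * (a + b - 1ℤ) ≤ a * n →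
    b * n ≤ (a + b) * U → U ≤ s + h₁ + h₂ → t + s ≤ n →
    t * (h₂ - b) - (h₂ - h₁) * (h₁ + 1ℤ) ≤ E → E + a * s ≤ -1ℤ → ⊥
  union-arithmetic a b n E s t h₁ h₂ U 1≤a a<b 0≤h₁ h₁≤h₂ h₂≤b order union U≤ t+s≤n E≥ deficient =
    0≰-1 (≤-trans (0≤+ (0≤+ (0≤+ (0≤+ (0≤+ (0≤+ (0≤+
        (0≤* 0≤c (i≤j⇒0≤j-i deficient))
        (0≤* 0≤c (i≤j⇒0≤j-i E≥)))
        (0≤* (0≤* 0≤c 0≤b-h₂) (i≤j⇒0≤j-i t+s≤n)))
        -- Replacing `t` by `n - s` gives `s` the coefficient `a + (b - h₂)`, which is therefore the
        -- weight of the two bounds that eliminate `s` and `U`. What is left of `n` is `a * h₂ * n`,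
        -- whence the multiplier `h₂` of `order`.
        (0≤* (0≤* (0≤+ 0≤a 0≤b-h₂) 0≤c) (i≤j⇒0≤j-i U≤)))
        (0≤* (0≤+ 0≤a 0≤b-h₂) (i≤j⇒0≤j-i union)))
        (0≤* (≤-trans 0≤h₁ h₁≤h₂) (i≤j⇒0≤j-i order)))
        (0≤* 0≤c (0≤+ (0≤+ (0≤+
          (0≤* (0≤+ (0≤* {+ 2} (+≤+ ℕ.z≤n) 0≤a-1) 0≤b-a-1) 0≤k)
          (0≤square (h₂ - h₁)))
          (0≤* {+ 2} (+≤+ ℕ.z≤n) (0≤i*[i-1] 0≤h₁)))
          (0≤* {+ 2} (+≤+ ℕ.z≤n) (0≤* 0≤h₁ 0≤k)))))
        (0≤+ 0≤a-1 0≤b))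
      (≤-reflexive (certificate a b n E s t h₁ h₂ U)))
    where
    0≤a-1 : 0ℤ ≤ a - 1ℤ
    0≤a-1 = i≤j⇒0≤j-i 1≤a
    0≤a : 0ℤ ≤ a
    0≤a = ≤-trans (+≤+ ℕ.z≤n) 1≤a
    0≤b-a-1 : 0ℤ ≤ b - (a + 1ℤ)
    0≤b-a-1 = i≤j⇒0≤j-i a<b
    0≤b : 0ℤ ≤ b
    0≤b = ≤-trans (0≤+ 0≤a (+≤+ ℕ.z≤n)) a<b
    0≤c : 0ℤ ≤ a + b
    0≤c = 0≤+ 0≤a 0≤b
    0≤b-h₂ : 0ℤ ≤ b - h₂
    0≤b-h₂ = i≤j⇒0≤j-i h₂≤b
    0≤k : 0ℤ ≤ h₂ - h₁
    0≤k = i≤j⇒0≤j-i h₁≤h₂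
    certificate : ∀ a b n E s t h₁ h₂ U →
      (a + b) * (-1ℤ - (E + a * s)) +
      (a + b) * (E - (t * (h₂ - b) - (h₂ - h₁) * (h₁ + 1ℤ))) +
      (a + b) * (b - h₂) * (n - (t + s)) +
      (a + (b - h₂)) * (a + b) * (s + h₁ + h₂ - U) +
      (a + (b - h₂)) * ((a + b) * U - b * n) +
      h₂ * (a * n - + 2 * (a + b) * (a + b - 1ℤ)) +
      (a + b) * ((+ 2 * (a - 1ℤ) + (b - (a + 1ℤ))) * (h₂ - h₁) + (h₂ - h₁) * (h₂ - h₁) +
        + 2 * (h₁ * (h₁ - 1ℤ)) + + 2 * (h₁ * (h₂ - h₁))) +
      ((a - 1ℤ) + b) ≡ -1ℤ
    certificate = solve-∀

-- Deficient pairs S, T of a graph.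

module Deficiency where

  open Transport
  open import Data.Integer hiding (suc)
  open import Data.Integer.Properties
  open import Data.Integer.Tactic.RingSolver using (solve-∀)

  private variable
    n : ℕ

  argmin : (P : Fin n → Bool) (f : Fin n → ℤ) →
    (∀ x → P x ≡ false) ⊎ (∃ λ x → P x ≡ true × (∀ y → P y ≡ true → f x ≤ f y))
  argmin {zero}  P f = inj₁ λ ()
  argmin {suc n} P f with P zero in P0 | argmin (P ∘ suc) (f ∘ suc)
  ... | false | inj₁ none = inj₁ λ { zero → P0 ; (suc y) → none y }
  ... | false | inj₂ (x , Px , least) = inj₂ (suc x , Px , λ
    { zero Py → ⊥-elim (Bool.not-¬ P0 Py) ; (suc y) Py → least y Py })
  ... | true  | inj₁ none = inj₂ (zero , P0 , λ
    { zero _ → ≤-refl ; (suc y) Py → ⊥-elim (Bool.not-¬ (none y) Py) })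
  ... | true  | inj₂ (x , Px , least) with ≤-total (f zero) (f (suc x))
  ...   | inj₁ f0≤fx = inj₂ (zero , P0 , λ
    { zero _ → ≤-refl ; (suc y) Py → ≤-trans f0≤fx (least y Py) })
  ...   | inj₂ fx≤f0 = inj₂ (suc x , Px , λ
    { zero _ → fx≤f0 ; (suc y) Py → least y Py })

  module _ (A : Fin n → Fin n → Bool) (A-sym : ∀ x y → A x y ≡ A y x) where

    K : Fin n → Fin n → ℤ
    K u v = ι (A u v)

    degreeOutside : (Fin n → Bool) → Fin n → ℤ
    degreeOutside S x = ∑ (λ y → ι (A x y ∧ not (S y)))

    -- The new cut gains the pairs (u, v) with u in `X` but not `Y` and v in both. Reversed, these
    -- are pairs of the old cut whose first vertex lies in `X` and `Y`, and the new cut has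
    -- discarded all such pairs; symmetry of `A` makes the exchange even.
    cut-disjoint : (X Y : Fin n → Bool) →
      cut K (λ u → X u ∧ not (Y u)) (λ v → Y v ∧ not (X v)) ≤ cut K X Y
    cut-disjoint X Y = begin
      cut K (λ u → X u ∧ not (Y u)) (λ v → Y v ∧ not (X v))
        ≡⟨ ∑-cong (λ u → ∑-cong (λ v → split (X u) (Y u) (X v) (Y v) (K u v))) ⟩
      ∑ (λ u → ∑ (λ v → left u v + right u v))
        ≡⟨ ∑∑-+ left right ⟩
      ∑ (λ u → ∑ (left u)) + ∑ (λ u → ∑ (right u))
        ≡⟨ cong (_+_ (∑ (λ u → ∑ (left u)))) (∑-comm right) ⟩
      ∑ (λ u → ∑ (left u)) + ∑ (λ u → ∑ (λ v → right v u))
        ≡⟨ sym (∑∑-+ left (λ u v → right v u)) ⟩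
      ∑ (λ u → ∑ (λ v → left u v + right v u))
        ≤⟨ ∑-mono (λ u → ∑-mono (λ v → merge (X u) (Y u) (X v) (Y v) (A-sym v u))) ⟩
      cut K X Y ∎
      where
      open ≤-Reasoning
      left right : Fin n → Fin n → ℤ
      left  u v = ι ((X u ∧ not (Y u)) ∧ not (Y v)) * K u v
      right u v = ι ((X u ∧ not (Y u)) ∧ (X v ∧ Y v)) * K u v
      split : ∀ p q s t k → ι ((p ∧ not q) ∧ not (t ∧ not s)) * k ≡
              ι ((p ∧ not q) ∧ not t) * k + ι ((p ∧ not q) ∧ (s ∧ t)) * k
      split false q     s     t     k = refl
      split true  true  s     t     k = refl
      split true  false false false k = sym (+-identityʳ (1ℤ * k))
      split true  false true  false k = sym (+-identityʳ (1ℤ * k))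
      split true  false false true  k = refl
      split true  false true  true  k = sym (+-identityˡ (1ℤ * k))
      merge : ∀ p q s t {α β} → β ≡ α →
              ι ((p ∧ not q) ∧ not t) * ι α + ι ((s ∧ not t) ∧ (p ∧ q)) * ι β ≤ ι (p ∧ not t) * ι α
      merge false q     false t     refl = ≤-refl
      merge false q     true  false refl = ≤-refl
      merge false q     true  true  refl = ≤-refl
      merge true  false false t     {α} refl = ≤-reflexive (+-identityʳ (ι (not t) * ι α))
      merge true  false true  false {α} refl = ≤-reflexive (+-identityʳ (1ℤ * ι α))
      merge true  false true  true  refl = ≤-refl
      merge true  true  false false {α} refl = 0≤* {1ℤ} (+≤+ ℕ.z≤n) (ι≥0 α)
      merge true  true  false true  refl = ≤-refl
      merge true  true  true  false {α} refl = ≤-reflexive (+-identityˡ (1ℤ * ι α))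
      merge true  true  true  true  refl = ≤-refl

    volume-difference : (X Y : Fin n → Bool) (q : Fin n → ℤ) →
      volume X q - volume Y q ≡
      volume (λ u → X u ∧ not (Y u)) q - volume (λ u → Y u ∧ not (X u)) q
    volume-difference X Y q = begin
      volume X q - volume Y q
        ≡⟨ sym (∑-minus _ _) ⟩
      ∑ (λ u → ι (X u) * q u - ι (Y u) * q u)
        ≡⟨ ∑-cong (λ u → pointwise (X u) (Y u) (q u)) ⟩
      ∑ (λ u → ι (X u ∧ not (Y u)) * q u - ι (Y u ∧ not (X u)) * q u)
        ≡⟨ ∑-minus _ _ ⟩
      volume (λ u → X u ∧ not (Y u)) q - volume (λ u → Y u ∧ not (X u)) q ∎
      where
      open ≡-Reasoning
      pointwise : ∀ s t k → ι s * k - ι t * k ≡ ι (s ∧ not t) * k - ι (t ∧ not s) * k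
      pointwise false false k = refl
      pointwise false true  k = refl
      pointwise true  false k = refl
      pointwise true  true  k = i≡j⇒i-j≡0 {1ℤ * k} refl

    -- An obstruction independent of `q`: vertices of `S` are charged the least demand `a`, those of
    -- `T` credited with the greatest, `b`. The field `low-degree` provides the sign of `d - b` on
    -- which both numerical contradictions depend.
    record Deficient (a b : ℤ) : Set where
      field
        S T         : Fin n → Bool
        disjoint    : ∀ x → T x ≡ true → S x ≡ false
        low-degree  : ∀ x → T x ≡ true → degreeOutside S x ≤ b
        deficiency  : ∑ (λ x → ι (T x) * (degreeOutside S x - b)) + a * ∑ (ι ∘ S) ≤ -1ℤ

    violated⇒deficient : (a b : ℤ) (q : Fin n → ℤ) → (∀ x → a ≤ q x × q x ≤ b) →
      Violated q q K → Deficient a b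
    violated⇒deficient a b q a≤q≤b (X , Y , 1≤excess) = record
      { S = S ; T = T
      ; disjoint = λ x → disjoint-bool (X x) (Y x) _
      ; low-degree = λ x Tx → low x Tx
      ; deficiency = ≤-byDifference
          (certificate (∑ (λ u → ι (T u) * (d u - b))) (a * ∑ (ι ∘ S)) (volume S q) (volume X′ q)
                       (cut K X′ S) (∑ (λ u → ι (X′ u) * b)) cut≡)
          (0≤+ (0≤+ (0≤+ (i≤j⇒0≤j-i 1≤excess′) (i≤j⇒0≤j-i volume-X′≤))
                    (i≤j⇒0≤j-i a*S≤)) (i≤j⇒0≤j-i filter≤))
      }
      where
      X′ S T : Fin n → Bool
      X′ u = X u ∧ not (Y u)
      S  u = Y u ∧ not (X u)
      d : Fin n → ℤ
      d = degreeOutside S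
      -- Vertices with `d u` above `b` contribute positive terms, so discarding them only lowers the
      -- sum.
      T u = X′ u ∧ does (d u ≤? b)

      disjoint-bool : ∀ p q r → (p ∧ not q) ∧ r ≡ true → q ∧ not p ≡ false
      disjoint-bool true false r _ = refl

      low : ∀ x → T x ≡ true → d x ≤ b
      low x Tx with X′ x | d x ≤? b
      ... | true | yes d≤b = d≤b

      cut≡ : cut K X′ S ≡ ∑ (λ u → ι (X′ u) * d u)
      cut≡ = ∑-cong (λ u → trans (∑-cong (λ v → pointwise (X′ u) (S v) (A u v)))
                                 (∑-*ˡ (ι (X′ u)) (λ v → ι (A u v ∧ not (S v)))))
        where
        pointwise : ∀ p s α → ι (p ∧ not s) * ι α ≡ ι p * ι (α ∧ not s)
        pointwise false s     α     = refl
        pointwise true  false false = refl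
        pointwise true  false true  = refl
        pointwise true  true  false = refl
        pointwise true  true  true  = refl

      1≤excess′ : 1ℤ ≤ volume X′ q - volume S q - cut K X′ S
      1≤excess′ = ≤-trans 1≤excess (≤-trans
        (≤-reflexive (cong (_- cut K X Y) (volume-difference X Y q)))
        (+-monoʳ-≤ (volume X′ q - volume S q) (neg-mono-≤ (cut-disjoint X Y))))

      ι*-mono : ∀ p {i j} → i ≤ j → ι p * i ≤ ι p * j
      ι*-mono false i≤j = ≤-refl
      ι*-mono true  i≤j = *-monoˡ-≤-nonNeg 1ℤ i≤j

      volume-X′≤ : volume X′ q ≤ ∑ (λ u → ι (X′ u) * b)
      volume-X′≤ = ∑-mono (λ u → ι*-mono (X′ u) (proj₂ (a≤q≤b u)))

      a*S≤ : a * ∑ (ι ∘ S) ≤ volume S q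
      a*S≤ = ≤-trans (≤-reflexive (sym (∑-*ˡ a (ι ∘ S)))) (∑-mono (λ u →
        ≤-trans (≤-reflexive (*-comm a (ι (S u)))) (ι*-mono (S u) (proj₁ (a≤q≤b u)))))

      filter≤ : ∑ (λ u → ι (T u) * (d u - b)) ≤ ∑ (λ u → ι (X′ u) * d u) - ∑ (λ u → ι (X′ u) * b)
      filter≤ = ≤-trans (∑-mono pointwise) (≤-reflexive (∑-minus _ _))
        where
        distrib : ∀ i j k → i * (j - k) ≡ i * j - i * k
        distrib = solve-∀
        pointwise : ∀ u → ι (T u) * (d u - b) ≤ ι (X′ u) * d u - ι (X′ u) * b
        pointwise u with X′ u | d u ≤? b
        ... | false | _       = ≤-refl
        ... | true  | yes _   = ≤-reflexive (distrib 1ℤ (d u) b)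
        ... | true  | no d≰b  = ≤-trans
          (0≤* {1ℤ} (+≤+ ℕ.z≤n) (i≤j⇒0≤j-i (<⇒≤ (≰⇒> d≰b)))) (≤-reflexive (distrib 1ℤ (d u) b))

      certificate : ∀ E as vS vX k kb {k′} → k ≡ k′ → -1ℤ - (E + as) ≡
        (vX - vS - k - 1ℤ) + (kb - vX) + (vS - as) + (k′ - kb - E)
      certificate E as vS vX k kb refl = ring E as vS vX k kb
        where
        ring : ∀ E as vS vX k kb → -1ℤ - (E + as) ≡
          (vX - vS - k - 1ℤ) + (kb - vX) + (vS - as) + (k - kb - E)
        ring = solve-∀

    -- Deficient pairs against the order, degree and union conditions.

    module _ (a b : ℤ) (1≤a : 1ℤ ≤ a) (a<b : a + 1ℤ ≤ b)
      (order : + 2 * (a + b) * (a + b - 1ℤ) ≤ a * + n)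
      (degree : ∀ x → (a + b - 1ℤ) * (a + b - 1ℤ) + + 4 * b ≤ + 4 * a * ∑ (ι ∘ A x))
      (union : ∀ u v → ¬ u ≡ v → A u v ≡ false →
        b * + n ≤ (a + b) * ∑ (λ y → ι (A u y ∨ A v y))) where

      not-deficient : ¬ Deficient a b
      not-deficient record { S = S ; T = T ; disjoint = disjoint ; low-degree = low-degree
                           ; deficiency = deficiency } = first (argmin T d)
        where
        d : Fin n → ℤ
        d = degreeOutside S
        s t E : ℤ
        s = ∑ (ι ∘ S)
        t = ∑ (ι ∘ T)
        E = ∑ (λ x → ι (T x) * (d x - b))

        0≤a : 0ℤ ≤ a
        0≤a = ≤-trans (+≤+ ℕ.z≤n) 1≤a

        d≥0 : ∀ x → 0ℤ ≤ d x
        d≥0 x = ∑-nonneg (λ y → ι≥0 (A x y ∧ not (S y)))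

        degree≤ : ∀ x → ∑ (ι ∘ A x) ≤ s + d x
        degree≤ x = ≤-trans (∑-mono (λ y → pointwise (A x y) (S y)))
                            (≤-reflexive (∑-+ (ι ∘ S) (λ y → ι (A x y ∧ not (S y)))))
          where
          pointwise : ∀ α σ → ι α ≤ ι σ + ι (α ∧ not σ)
          pointwise false false = ≤-refl
          pointwise false true  = +≤+ ℕ.z≤n
          pointwise true  false = ≤-refl
          pointwise true  true  = ≤-refl

        union≤ : ∀ x y → ∑ (λ z → ι (A x z ∨ A y z)) ≤ s + d x + d y
        union≤ x y = ≤-trans (∑-mono (λ z → pointwise (A x z) (A y z) (S z))) (≤-reflexive
          (trans (∑-+ (λ z → ι (S z) + ι (A x z ∧ not (S z))) (λ z → ι (A y z ∧ not (S z))))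
                 (cong (_+ d y) (∑-+ (ι ∘ S) (λ z → ι (A x z ∧ not (S z)))))))
          where
          pointwise : ∀ α β σ → ι (α ∨ β) ≤ ι σ + ι (α ∧ not σ) + ι (β ∧ not σ)
          pointwise false false false = ≤-refl
          pointwise false false true  = +≤+ ℕ.z≤n
          pointwise false true  false = ≤-refl
          pointwise false true  true  = ≤-refl
          pointwise true  false false = ≤-refl
          pointwise true  false true  = ≤-refl
          pointwise true  true  false = +≤+ (ℕ.s≤s ℕ.z≤n)
          pointwise true  true  true  = ≤-refl

        t+s≤n : t + s ≤ + n
        t+s≤n = ≤-trans (≤-reflexive (sym (∑-+ (ι ∘ T) (ι ∘ S))))
          (≤-trans (∑-mono (λ x → pointwise (T x) (S x) (disjoint x))) (≤-reflexive (∑-one n)))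
          where
          pointwise : ∀ τ σ → (τ ≡ true → σ ≡ false) → ι τ + ι σ ≤ 1ℤ
          pointwise false false _ = +≤+ ℕ.z≤n
          pointwise false true  _ = ≤-refl
          pointwise true  false _ = ≤-refl
          pointwise true  true  h with () ← h refl

        E-empty : (∀ x → T x ≡ false) → E ≡ 0ℤ
        E-empty none = ∑-zero (λ x → cong (λ τ → ι τ * (d x - b)) (none x))

        neighbourhood-sum : ∀ x → ∑ (λ y → ι (A x y ∧ not (S y)) + δ x y) ≡ d x + 1ℤ
        neighbourhood-sum x = trans (∑-+ (λ y → ι (A x y ∧ not (S y))) (δ x))
          (cong (_+_ (d x)) (trans (∑-cong (λ y → sym (*-identityˡ (δ x y)))) (∑-δ (λ _ → 1ℤ) x)))

        farFrom : Fin n → Fin n → Bool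
        farFrom x y = T y ∧ (not (A x y) ∧ not (does (x Fin.≟ y)))

        first : ((∀ x → T x ≡ false) ⊎ (∃ λ x → T x ≡ true × (∀ y → T y ≡ true → d x ≤ d y))) → ⊥
        first (inj₁ none) = 0≰-1 (≤-trans
          (0≤+ (≤-reflexive (sym (E-empty none))) (0≤* 0≤a (∑-nonneg (ι≥0 ∘ S)))) deficiency)
        first (inj₂ (x₁ , Tx₁ , least₁)) = second (argmin (farFrom x₁) d)
          where
          second : ((∀ y → farFrom x₁ y ≡ false) ⊎
            (∃ λ x → farFrom x₁ x ≡ true × (∀ y → farFrom x₁ y ≡ true → d x ≤ d y))) → ⊥
          second (inj₁ none) = degree-arithmetic a b E s t (d x₁) (∑ (ι ∘ A x₁)) 0≤a
            (low-degree x₁ Tx₁) (degree x₁) (degree≤ x₁) t≤ E≥ deficiency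
            where
            -- Every vertex of `T` is outside `S` and in the closed neighbourhood of `x₁`; the extra
            -- 1 counts `x₁` itself.
            t≤ : t ≤ d x₁ + 1ℤ
            t≤ = ≤-trans (∑-mono (λ y → pointwise (T y) (A x₁ y) (S y) (does (x₁ Fin.≟ y))
                                                  (disjoint y) (none y)))
                         (≤-reflexive (neighbourhood-sum x₁))
              where
              pointwise : ∀ τ α σ ε → (τ ≡ true → σ ≡ false) → τ ∧ (not α ∧ not ε) ≡ false →
                          ι τ ≤ ι (α ∧ not σ) + ι ε
              pointwise false α     σ     ε     _ _ = 0≤+ (ι≥0 (α ∧ not σ)) (ι≥0 ε)
              pointwise true  α     true  ε     h _ with () ← h refl
              pointwise true  true  false ε     _ _ = +-monoʳ-≤ 1ℤ (ι≥0 ε)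
              pointwise true  false false true  _ _ = ≤-refl
            E≥ : t * (d x₁ - b) ≤ E
            E≥ = ≤-trans (≤-reflexive (trans (*-comm t (d x₁ - b)) (sym (∑-*ˡ (d x₁ - b) (ι ∘ T)))))
                         (∑-mono (λ y → pointwise (T y) (least₁ y)))
              where
              pointwise : ∀ τ {j} → (τ ≡ true → d x₁ ≤ j) → (d x₁ - b) * ι τ ≤ ι τ * (j - b)
              pointwise false _ = ≤-reflexive (*-zeroʳ (d x₁ - b))
              pointwise true  h = ≤-trans (≤-reflexive (*-comm (d x₁ - b) 1ℤ))
                (*-monoˡ-≤-nonNeg 1ℤ (+-monoˡ-≤ (- b) (h refl)))
          second (inj₂ (x₂ , far-x₂ , least₂)) =
            union-arithmetic a b (+ n) E s t (d x₁) (d x₂) (∑ (λ z → ι (A x₁ z ∨ A x₂ z)))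
              1≤a a<b (d≥0 x₁) (least₁ x₂ Tx₂) (low-degree x₂ Tx₂) order
              (union x₁ x₂ x₁≢x₂ nonadjacent) (union≤ x₁ x₂) t+s≤n E≥ deficiency
            where
            Tx₂ : T x₂ ≡ true
            Tx₂ with T x₂
            ... | true = refl
            nonadjacent : A x₁ x₂ ≡ false
            nonadjacent with T x₂ | A x₁ x₂
            ... | true | false = refl
            x₁≢x₂ : ¬ x₁ ≡ x₂
            x₁≢x₂ x₁≡x₂ with T x₂ | A x₁ x₂ | x₁ Fin.≟ x₂
            ... | true | false | no x₁≢x₂ = x₁≢x₂ x₁≡x₂
            k : ℤ
            k = d x₂ - d x₁
            0≤k : 0ℤ ≤ k
            0≤k = i≤j⇒0≤j-i (least₁ x₂ Tx₂)
            -- Each vertex of `T` is first credited with degree `d x₂`. Those in the closed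
            -- neighbourhood of `x₁` only guarantee `d x₁`, so `k` is taken back for each; outside
            -- `S` that neighbourhood has at most `d x₁ + 1` vertices.
            E≥ : t * (d x₂ - b) - k * (d x₁ + 1ℤ) ≤ E
            E≥ = begin
              t * (d x₂ - b) - k * (d x₁ + 1ℤ)
                ≡⟨ cong₂ (λ p q → p - q)
                     (trans (*-comm t (d x₂ - b)) (sym (∑-*ˡ (d x₂ - b) (ι ∘ T))))
                     (trans (cong (_*_ k) (sym (neighbourhood-sum x₁)))
                            (sym (∑-*ˡ k (λ y → ι (A x₁ y ∧ not (S y)) + δ x₁ y)))) ⟩
              ∑ (λ y → (d x₂ - b) * ι (T y)) - ∑ (λ y → k * (ι (A x₁ y ∧ not (S y)) + δ x₁ y))
                ≡⟨ sym (∑-minus (λ y → (d x₂ - b) * ι (T y))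
                                (λ y → k * (ι (A x₁ y ∧ not (S y)) + δ x₁ y))) ⟩
              ∑ (λ y → (d x₂ - b) * ι (T y) - k * (ι (A x₁ y ∧ not (S y)) + δ x₁ y))
                ≤⟨ ∑-mono (λ y → pointwise (T y) (A x₁ y) (S y) (does (x₁ Fin.≟ y)) (d y)
                                           (disjoint y) (least₁ y) (least₂ y)) ⟩
              E ∎
              where
              open ≤-Reasoning
              certificate₀ : ∀ h₂ b k i → 0ℤ - ((h₂ - b) * 0ℤ - k * i) ≡ k * i
              certificate₀ = solve-∀
              certificate₁ : ∀ h₁ h₂ b j i → 1ℤ * (j - b) -
                ((h₂ - b) * 1ℤ - (h₂ - h₁) * (1ℤ + i)) ≡ (j - h₁) + (h₂ - h₁) * i
              certificate₁ = solve-∀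
              certificate₂ : ∀ h₁ h₂ b j → 1ℤ * (j - b) -
                ((h₂ - b) * 1ℤ - (h₂ - h₁) * (0ℤ + 1ℤ)) ≡ j - h₁
              certificate₂ = solve-∀
              certificate₃ : ∀ h₂ b k j → 1ℤ * (j - b) -
                ((h₂ - b) * 1ℤ - k * 0ℤ) ≡ j - h₂
              certificate₃ = solve-∀
              pointwise : ∀ τ α σ ε j → (τ ≡ true → σ ≡ false) → (τ ≡ true → d x₁ ≤ j) →
                (τ ∧ (not α ∧ not ε) ≡ true → d x₂ ≤ j) →
                (d x₂ - b) * ι τ - k * (ι (α ∧ not σ) + ι ε) ≤ ι τ * (j - b)
              pointwise false α σ ε j _ _ _ = ≤-byDifference
                (certificate₀ (d x₂) b k (ι (α ∧ not σ) + ι ε))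
                (0≤* 0≤k (0≤+ (ι≥0 (α ∧ not σ)) (ι≥0 ε)))
              pointwise true α     true  ε     j h _  _  with () ← h refl
              pointwise true true  false ε     j _ h₁ _  = ≤-byDifference
                (certificate₁ (d x₁) (d x₂) b j (ι ε)) (0≤+ (i≤j⇒0≤j-i (h₁ refl)) (0≤* 0≤k (ι≥0 ε)))
              pointwise true false false true  j _ h₁ _  = ≤-byDifference
                (certificate₂ (d x₁) (d x₂) b j) (i≤j⇒0≤j-i (h₁ refl))
              pointwise true false false false j _ _  h₂ = ≤-byDifference
                (certificate₃ (d x₂) b k j) (i≤j⇒0≤j-i (h₂ refl))

-- From integral flows to fractional factors.

module Fractional where

  open Transport
  open Deficiency
  open import Data.Integer hiding (suc)
  open import Data.Integer.Properties
  open import Data.Integer.Tactic.RingSolver using (solve-∀)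
  open import Data.Rational as ℚ using (ℚ; 0ℚ; 1ℚ; toℚᵘ; fromℚᵘ)
  import Data.Rational.Properties as ℚ
  open import Data.Rational.Unnormalised as ℚᵘ using (mkℚᵘ; *≡*; *≤*)
  import Data.Rational.Unnormalised.Properties as ℚᵘ

  private variable
    n : ℕ

  -- This is i/2: the second argument of `mkℚᵘ` is the denominator minus one.
  half : ℤ → ℚ
  half i = fromℚᵘ (mkℚᵘ i 1)

  half-+ : ∀ i j → half i ℚ.+ half j ≡ half (i + j)
  half-+ i j = ℚ.toℚᵘ-injective (begin
    toℚᵘ (half i ℚ.+ half j)           ≈⟨ ℚ.toℚᵘ-homo-+ (half i) (half j) ⟩
    toℚᵘ (half i) ℚᵘ.+ toℚᵘ (half j)   ≈⟨ ℚᵘ.+-cong (ℚ.toℚᵘ-fromℚᵘ (mkℚᵘ i 1)) (ℚ.toℚᵘ-fromℚᵘ (mkℚᵘ j 1)) ⟩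
    mkℚᵘ i 1 ℚᵘ.+ mkℚᵘ j 1             ≈⟨ *≡* (cross i j) ⟩
    mkℚᵘ (i + j) 1                     ≈⟨ ℚᵘ.≃-sym (ℚ.toℚᵘ-fromℚᵘ (mkℚᵘ (i + j) 1)) ⟩
    toℚᵘ (half (i + j)) ∎)
    where
    open ℚᵘ.≃-Reasoning
    cross : ∀ i j → (i * + 2 + j * + 2) * + 2 ≡ (i + j) * + 4
    cross = solve-∀

  half-double : ∀ i → half (i + i) ≡ i ℚ./ 1
  half-double i = ℚ.fromℚᵘ-cong {mkℚᵘ (i + i) 1} {mkℚᵘ i 0} (*≡* (cross i))
    where
    cross : ∀ i → (i + i) * 1ℤ ≡ i * + 2
    cross = solve-∀

  half-mono : ∀ {i j} → i ≤ j → half i ℚ.≤ half j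
  half-mono {i} {j} i≤j = ℚ.toℚᵘ-cancel-≤ (begin
    toℚᵘ (half i)  ≃⟨ ℚ.toℚᵘ-fromℚᵘ (mkℚᵘ i 1) ⟩
    mkℚᵘ i 1       ≤⟨ *≤* (*-monoʳ-≤-nonNeg (+ 2) i≤j) ⟩
    mkℚᵘ j 1       ≃⟨ ℚᵘ.≃-sym (ℚ.toℚᵘ-fromℚᵘ (mkℚᵘ j 1)) ⟩
    toℚᵘ (half j)  ∎)
    where open ℚᵘ.≤-Reasoning

  sumℚ-cong : {f g : Fin n → ℚ} → (∀ i → f i ≡ g i) → sumℚ f ≡ sumℚ g
  sumℚ-cong {zero}  f≡g = refl
  sumℚ-cong {suc n} f≡g = cong₂ ℚ._+_ (f≡g zero) (sumℚ-cong (f≡g ∘ suc))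

  sumℚ-half : (f : Fin n → ℤ) → sumℚ (half ∘ f) ≡ half (∑ f)
  sumℚ-half {zero}  f = sym (cong half (∑-empty f))
  sumℚ-half {suc n} f = trans (cong (ℚ._+_ (half (f zero))) (sumℚ-half (f ∘ suc)))
    (trans (half-+ (f zero) (∑ (f ∘ suc))) (sym (cong half (∑-suc f))))

  +-sumℕ : (f : Fin n → ℕ) → + sumℕ f ≡ ∑ (λ i → + f i)
  +-sumℕ {zero}  f = sym (∑-empty (λ i → + f i))
  +-sumℕ {suc n} f = trans (pos-+ (f zero) (sumℕ (f ∘ suc)))
    (trans (cong (_+_ (+ f zero)) (+-sumℕ (f ∘ suc))) (sym (∑-suc (λ i → + f i))))

  +-count : (P : Fin n → Bool) → + sumℕ (λ i → if P i then 1 else 0) ≡ ∑ (ι ∘ P)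
  +-count P = trans (+-sumℕ (λ i → if P i then 1 else 0)) (∑-cong (λ i → pointwise (P i)))
    where
    pointwise : ∀ b → + (if b then 1 else 0) ≡ ι b
    pointwise false = refl
    pointwise true  = refl

  term≤∑ : {f : Fin n → ℤ} → (∀ i → 0ℤ ≤ f i) → ∀ x → f x ≤ ∑ f
  term≤∑ {f = f} 0≤f x = ≤-trans (≤-reflexive (sym (∑-δ f x)))
    (∑-mono (λ u → pointwise (does (x Fin.≟ u)) (0≤f u)))
    where
    pointwise : ∀ b {i} → 0ℤ ≤ i → i * ι b ≤ i
    pointwise false {i} 0≤i = ≤-trans (≤-reflexive (*-zeroʳ i)) 0≤i
    pointwise true  {i} 0≤i = ≤-reflexive (*-identityʳ i)

  -- The differences `g i - f i` are nonnegative, so each is at most their sum, which is at most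
  -- zero.
  ∑-squeeze : {f g : Fin n → ℤ} → (∀ i → f i ≤ g i) → ∑ g ≤ ∑ f → ∀ x → f x ≡ g x
  ∑-squeeze {f = f} {g} f≤g ∑g≤∑f x = ≤-antisym (f≤g x) (i-j≤0⇒i≤j (begin
    g x - f x            ≤⟨ term≤∑ {f = λ i → g i - f i} (λ i → i≤j⇒0≤j-i (f≤g i)) x ⟩
    ∑ (λ i → g i - f i)  ≡⟨ ∑-minus g f ⟩
    ∑ g - ∑ f            ≤⟨ i≤j⇒i-j≤0 ∑g≤∑f ⟩
    0ℤ ∎))
    where open ≤-Reasoning

  feasible⇒fractionalFactor : (G : SimpleGraph n) (q : Fin n → ℕ) →
    Feasible (λ x → + q x) (λ x → + q x) (λ x y → ι (adj G x y)) → HasFractionalFactor G q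
  feasible⇒fractionalFactor {n} G q (w , bounds , rows , columns) =
    h , (λ x y _ → cong half (+-comm (w x y) (w y x))) ,
    (λ x y _ → half-mono (0≤+ (proj₁ (bounds x y)) (proj₁ (bounds y x))) ,
               half-mono (+-mono-≤ (≤-trans (proj₂ (bounds x y)) (ι≤1 (adj G x y)))
                                   (≤-trans (proj₂ (bounds y x)) (ι≤1 (adj G y x))))) ,
    factor
    where
    h : Fin n → Fin n → ℚ
    h x y = half (w x y + w y x)

    ι≤1 : ∀ b → ι b ≤ 1ℤ
    ι≤1 false = +≤+ ℕ.z≤n
    ι≤1 true  = ≤-refl

    row column : Fin n → ℤ
    row x    = ∑ (w x)
    column x = ∑ (λ y → w y x)

    -- Row sums are at least `q` and column sums at most `q`, but both add up to the total of `w`;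
    -- no inequality can be strict.
    row≡ : ∀ x → + q x ≡ row x
    row≡ = ∑-squeeze rows (≤-trans (≤-reflexive (∑-comm w)) (∑-mono columns))

    column≡ : ∀ x → column x ≡ + q x
    column≡ = ∑-squeeze columns (≤-trans (∑-mono rows) (≤-reflexive (∑-comm w)))

    off-edge : ∀ {x y} → adj G x y ≡ false → w x y ≡ 0ℤ
    off-edge {x} {y} e = ≤-antisym (subst (λ b → w x y ≤ ι b) e (proj₂ (bounds x y)))
                                   (proj₁ (bounds x y))

    -- Off the edges the capacity is zero in both directions, so the sum over neighbours is a full
    -- row sum plus a full column sum, halved.
    drop-adj : ∀ x y b → adj G x y ≡ b → (if b then h x y else 0ℚ) ≡ h x y
    drop-adj x y true  e = refl
    drop-adj x y false e = sym (cong half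
      (cong₂ _+_ (off-edge e) (off-edge (trans (SimpleGraph.sym G y x) e))))

    factor : ∀ x → sumℚ (λ y → if adj G x y then h x y else 0ℚ) ≡ ℕtoℚ (q x)
    factor x = begin
      sumℚ (λ y → if adj G x y then h x y else 0ℚ)
        ≡⟨ sumℚ-cong (λ y → drop-adj x y (adj G x y) refl) ⟩
      sumℚ (λ y → half (w x y + w y x))
        ≡⟨ sumℚ-half (λ y → w x y + w y x) ⟩
      half (∑ (λ y → w x y + w y x))
        ≡⟨ cong half (∑-+ (w x) (λ y → w y x)) ⟩
      half (row x + column x)
        ≡⟨ cong half (cong₂ _+_ (sym (row≡ x)) (column≡ x)) ⟩
      half (+ q x + + q x)
        ≡⟨ half-double (+ q x) ⟩
      ℕtoℚ (q x) ∎
      where open ≡-Reasoning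

  not-deficient⇒allFactors : (a b : ℕ) (G : SimpleGraph n) →
    ¬ Deficient (adj G) (SimpleGraph.sym G) (+ a) (+ b) → HasAllFractionalFactors G a b
  not-deficient⇒allFactors a b G sufficient q a≤q≤b
    -- The bound for the induction is the total capacity itself, a nonnegative integer read as a
    -- natural number.
    with transport ∣ ∑ (λ x → ∑ (λ y → ι (adj G x y))) ∣ (λ x → + q x) (λ x → + q x)
                   (λ x y → ι (adj G x y)) (λ x y → ι≥0 (adj G x y))
                   (≤-reflexive (sym (0≤i⇒+∣i∣≡i (∑-nonneg (λ x → ∑-nonneg (λ y → ι≥0 (adj G x y)))))))
  ... | inj₁ feasible = feasible⇒fractionalFactor G q feasible
  ... | inj₂ violated = ⊥-elim (sufficient (violated⇒deficient (adj G) (SimpleGraph.sym G) (+ a) (+ b)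
    (λ x → + q x) (λ x → +≤+ (proj₁ (a≤q≤b x)) , +≤+ (proj₂ (a≤q≤b x))) violated))

  -- Translation of the hypotheses from naturals to integers.

  -- The truncated `∸` agrees with integer subtraction because `a + b` is positive.
  pos-pred : (a b : ℕ) → 0 ℕ.< a → + (a ℕ.+ b ℕ.∸ 1) ≡ + a + + b - 1ℤ
  pos-pred (suc a) b _ = refl

  order-ℤ : (a b n : ℕ) → 0 ℕ.< a → 2 ℕ.* (a ℕ.+ b) ℕ.* (a ℕ.+ b ℕ.∸ 1) ℕ.≤ a ℕ.* n →
    + 2 * (+ a + + b) * (+ a + + b - 1ℤ) ≤ + a * + n
  order-ℤ a b n 0<a h = begin
    + 2 * (+ a + + b) * (+ a + + b - 1ℤ)
      ≡⟨ cong₂ _*_ (sym (pos-* 2 (a ℕ.+ b))) (sym (pos-pred a b 0<a)) ⟩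
    + (2 ℕ.* (a ℕ.+ b)) * + (a ℕ.+ b ℕ.∸ 1)
      ≡⟨ sym (pos-* (2 ℕ.* (a ℕ.+ b)) (a ℕ.+ b ℕ.∸ 1)) ⟩
    + (2 ℕ.* (a ℕ.+ b) ℕ.* (a ℕ.+ b ℕ.∸ 1))
      ≤⟨ +≤+ h ⟩
    + (a ℕ.* n)
      ≡⟨ pos-* a n ⟩
    + a * + n ∎
    where open ≤-Reasoning

  degree-ℤ : (a b : ℕ) (P : Fin n → Bool) → 0 ℕ.< a →
    (a ℕ.+ b ℕ.∸ 1) ℕ.^ 2 ℕ.+ 4 ℕ.* b ℕ.≤ 4 ℕ.* a ℕ.* sumℕ (λ y → if P y then 1 else 0) →
    (+ a + + b - 1ℤ) * (+ a + + b - 1ℤ) + + 4 * + b ≤ + 4 * + a * ∑ (ι ∘ P)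
  degree-ℤ a b P 0<a h = begin
    (+ a + + b - 1ℤ) * (+ a + + b - 1ℤ) + + 4 * + b
      ≡⟨ cong (λ c → c * c + + 4 * + b) (sym (pos-pred a b 0<a)) ⟩
    + c-1 * + c-1 + + 4 * + b
      ≡⟨ cong₂ _+_ (sym (pos-* c-1 c-1)) (sym (pos-* 4 b)) ⟩
    + (c-1 ℕ.* c-1 ℕ.+ 4 ℕ.* b)
      -- The power `c-1 ^ 2` unfolds to `c-1 * (c-1 * 1)`, which accounts for the identity law.
      ≡⟨ cong (λ s → + (c-1 ℕ.* s ℕ.+ 4 ℕ.* b)) (sym (ℕ.*-identityʳ c-1)) ⟩
    + (c-1 ℕ.^ 2 ℕ.+ 4 ℕ.* b)
      ≤⟨ +≤+ h ⟩
    + (4 ℕ.* a ℕ.* sumℕ (λ y → if P y then 1 else 0))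
      ≡⟨ pos-* (4 ℕ.* a) _ ⟩
    + (4 ℕ.* a) * + sumℕ (λ y → if P y then 1 else 0)
      ≡⟨ cong₂ _*_ (pos-* 4 a) (+-count P) ⟩
    + 4 * + a * ∑ (ι ∘ P) ∎
    where
    open ≤-Reasoning
    c-1 = a ℕ.+ b ℕ.∸ 1

  union-ℤ : (a b m : ℕ) (P : Fin n → Bool) →
    b ℕ.* m ℕ.≤ (a ℕ.+ b) ℕ.* sumℕ (λ y → if P y then 1 else 0) →
    + b * + m ≤ (+ a + + b) * ∑ (ι ∘ P)
  union-ℤ a b m P h = begin
    + b * + m
      ≡⟨ sym (pos-* b m) ⟩
    + (b ℕ.* m)
      ≤⟨ +≤+ h ⟩
    + ((a ℕ.+ b) ℕ.* sumℕ (λ y → if P y then 1 else 0))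
      ≡⟨ pos-* (a ℕ.+ b) _ ⟩
    (+ a + + b) * + sumℕ (λ y → if P y then 1 else 0)
      ≡⟨ cong (_*_ (+ a + + b)) (+-count P) ⟩
    (+ a + + b) * ∑ (ι ∘ P) ∎
    where open ≤-Reasoning

  successor-≤ : ∀ {a b} → a ℕ.< b → + a + 1ℤ ≤ + b
  successor-≤ {a} a<b = ≤-trans (≤-reflexive (+-comm (+ a) 1ℤ)) (+≤+ a<b)

open import Data.Nat using (_+_; _*_; _∸_; _^_; _≤_; _<_)

-- The rational bounds appear with denominators cleared: the order bound times `a`, the degree bound
-- times `4 * a`, the union bound times `a + b`.
theorem7 : (a b : ℕ) → 0 < a → a < b →
    (n : ℕ) (G : SimpleGraph n) →
    2 * (a + b) * (a + b ∸ 1) ≤ a * n →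
    (∀ x → (a + b ∸ 1) ^ 2 + 4 * b ≤ 4 * a * degree G x) →
    (∀ u v → ¬ (u ≡ v) → adj G u v ≡ false → b * n ≤ (a + b) * unionNbhdSize G u v) →
    HasAllFractionalFactors G a b
theorem7 a b 0<a a<b n G order minDegree union =
  Fractional.not-deficient⇒allFactors a b G
    (Deficiency.not-deficient (adj G) (SimpleGraph.sym G) (ℤ.+ a) (ℤ.+ b) (ℤ.+≤+ 0<a)
      (Fractional.successor-≤ a<b)
      (Fractional.order-ℤ a b n 0<a order)
      (λ x → Fractional.degree-ℤ a b (adj G x) 0<a (minDegree x))
      (λ u v u≢v uv∉G → Fractional.union-ℤ a b n (λ y → adj G u y ∨ adj G v y) (union u v u≢v uv∉G)))
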